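{- For all positive integers $k$ and $\alpha$ with $\alpha < k$, there exists an unsatisfiable $\alpha$-intersecting $k$-CNF formula which simultaneously has at most $$U_i = \alpha^2\, 2^{(k+\alpha)(2+1/\alpha)}\, k^{(5+2/\alpha)}$$ clause intersection pairs, at most $$U_n = 2\alpha\, 2^{k/\alpha}\, k^{2(1+1/\alpha)}$$ variables, at most $$U_m = \alpha\, 2^{(k+\alpha)(1+1/\alpha)}\, k^{2(1+1/\alpha)}$$ clauses, and maximum clause degree at most $$U_{\Delta} = \alpha\, 2^{(k+\alpha)}\, k^2 .$$
   Context: A $k$-CNF formula is a conjunction of clauses, each clause being a disjunction of exactly $k$ literals over $k$ distinct Boolean variables; the same set of variables may underlie several clauses. The number of variables is the number of distinct variables occurring in the formula. A $k$-CNF formula is $\alpha$-intersecting if any two distinct clauses share at most $\alpha$ variables. A clause intersection pair is an unordered pair of distinct clauses that share at least one variable. The degree of a clause is the number of other clauses sharing at least one variable with it, and the maximum clause degree is the maximum of this over all clauses. -}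

module Defs where

open import Data.Nat using (ℕ; _≤_; _<_; _≤?_; _^_; _*_; _+_)
import Data.Nat as ℕ
open import Data.Bool using (Bool)
open import Data.Product using (_×_; _,_; proj₁; ∃-syntax)
open import Data.List using (List; []; _∷_; map; length; filter; concat; deduplicate; lookup)
open import Data.List.Relation.Unary.All using (All)
open import Data.List.Relation.Unary.Any using (Any)
open import Data.List.Relation.Unary.Linked using (Linked)
open import Data.List.Relation.Unary.Unique.Propositional using (Unique)
open import Data.List.Membership.DecPropositional ℕ._≟_ using (_∈?_)
open import Data.Fin using (Fin)
import Data.Fin as Fin
open import Relation.Binary.PropositionalEquality using (_≡_; _≢_)
open import Relation.Nullary using (¬_)
open import Relation.Nullary.Decidable using (¬?; _×-dec_)

-- A literal: a variable (a natural number) together with its sign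
-- (true = positive literal x, false = negative literal ¬x).
Literal : Set
Literal = ℕ × Bool

-- A clause is represented canonically as a list of literals whose
-- variables are strictly increasing (so the variables are distinct and
-- the representation of a clause as a set of literals is unique).
Clause : Set
Clause = List Literal

-- A CNF formula: a list of clauses (required to be duplicate-free below,
-- so it represents a set of clauses).
CNF : Set
CNF = List Clause

vars : Clause → List ℕ
vars = map proj₁

IsKClause : ℕ → Clause → Set
IsKClause k C = Linked _<_ (vars C) × length C ≡ k

IsKCNF : ℕ → CNF → Set
IsKCNF k F = All (IsKClause k) F × Unique F

shared : Clause → Clause → ℕ
shared C D = length (filter (_∈? vars D) (vars C))

Intersect : Clause → Clause → Set
Intersect C D = 1 ≤ shared C D

AlphaIntersecting : ℕ → CNF → Set
AlphaIntersecting α F =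
  (i j : Fin (length F)) → i ≢ j → shared (lookup F i) (lookup F j) ≤ α

SatLit : (ℕ → Bool) → Literal → Set
SatLit σ (v , b) = σ v ≡ b

SatClause : (ℕ → Bool) → Clause → Set
SatClause σ C = Any (SatLit σ) C

Satisfiable : CNF → Set
Satisfiable F = ∃[ σ ] All (SatClause σ) F

Unsatisfiable : CNF → Set
Unsatisfiable F = ¬ Satisfiable F

numVars : CNF → ℕ
numVars F = length (deduplicate ℕ._≟_ (concat (map vars F)))

numClauses : CNF → ℕ
numClauses = length

-- number of clause intersection pairs: unordered pairs of distinct clauses
-- (i.e. of distinct positions, the clauses being pairwise distinct)
-- sharing at least one variable
intersectionPairs : CNF → ℕ
intersectionPairs [] = 0
intersectionPairs (C ∷ F) =
  length (filter (λ D → 1 ≤? shared C D) F) + intersectionPairs F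

degree : (F : CNF) → Fin (length F) → ℕ
degree F i =
  length (filter (λ j → ¬? (j Fin.≟ i) ×-dec (1 ≤? shared (lookup F i) (lookup F j)))
                 (Data.List.allFin (length F)))
  where import Data.List

MaxDegreeAtMost : ℕ → CNF → Set
MaxDegreeAtMost d F = (i : Fin (length F)) → degree F i ≤ d

{-# OPTIONS --safe #-}
module Submission where

-- Fix q with 2^k k^(α+2) < q^α ≤ 2^α 2^k k^(α+2) and use the k q variables (i , y), i < k, y < q.
-- A word in [q]^k is a set of k variables, and two words share exactly the variables at the
-- positions where they agree.  Greedily, one finds k 2^k words such that no shift of one
-- (adding a constant modulo q to all letters) agrees with another in more than α positions.
-- Taking all q shifts of all these words gives 2^k times as many clauses as variables, while each
-- variable lies in only k 2^k clauses, whence the bound on the degrees.  Signs are chosen clause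
-- by clause so as to falsify at least a fraction 2^-k of the assignments satisfying all previous
-- clauses; with 2^k clauses per variable no assignment survives.

open import Defs
open import Data.Bool using (Bool; true; false; not)
import Data.Bool as Bool
import Data.Bool.Properties as Bool
open import Data.Nat using (ℕ; zero; suc; _≤_; _<_; _≤?_; _^_; _*_; _+_; _∸_; z≤n; s≤s; NonZero; >-nonZero)
import Data.Nat as ℕ
open import Data.Nat.DivMod using (_%_; _mod_; m%n<n; m<n⇒m%n≡m; [m+n]%n≡m%n; %-distribˡ-+; m%n%n≡m%n)
open import Data.Nat.Properties hiding (_≟_)
open import Data.Nat.Tactic.RingSolver using (solve-∀)
open import Data.Fin using (Fin; zero; suc; toℕ; fromℕ<; _≟_)
open import Data.Fin.Properties using (toℕ-fromℕ<; toℕ-injective; toℕ<n; toℕ≤n; injective⇒≤; fromℕ<-injective)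
open import Data.Product using (∃-syntax; _×_; _,_; proj₁; proj₂; swap)
open import Data.Sum using (_⊎_; inj₁; inj₂; fromInj₂)
open import Data.List using (List; []; _∷_; _++_; map; length; filter; cartesianProductWith; concat; allFin; lookup)
open import Data.List.Properties using
  (length-++; filter-++; length-filter; length-map; filter-none; filter-all; length-tabulate;
   map-tabulate; tabulate-lookup)
open import Data.List.Membership.DecPropositional ℕ._≟_ using (_∈?_)
open import Data.List.Membership.Propositional using (_∈_)
open import Data.List.Membership.Propositional.Properties using
  (∈-filter⁺; ∈-filter⁻; ∈-cartesianProductWith⁺; ∈-cartesianProductWith⁻; ∈-length; ∈-allFin; ∈-lookup)
open import Data.List.Relation.Unary.All as All using (All; []; _∷_)
import Data.List.Relation.Unary.All.Properties as All
open import Data.List.Relation.Unary.AllPairs as AllPairs using (AllPairs; []; _∷_)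
import Data.List.Relation.Unary.AllPairs.Properties as AllPairs
open import Data.List.Relation.Unary.Any as Any using (here; there)
open import Data.List.Relation.Unary.Linked.Properties using (AllPairs⇒Linked)
open import Data.List.Relation.Unary.Unique.DecPropositional.Properties ℕ._≟_ using (deduplicate-!)
open import Data.List.Relation.Unary.Unique.Propositional using (Unique)
open import Data.List.Relation.Unary.Unique.Propositional.Properties using (allFin⁺)
open import Data.Vec as Vec using (Vec; []; _∷_)
open import Function using (_∘_; id; it)
open import Level using (0ℓ)
open import Relation.Binary.Definitions using (Symmetric)
open import Relation.Binary.PropositionalEquality
open import Relation.Nullary using (¬_; Dec; yes; no; contradiction)
open import Relation.Nullary.Decidable using (¬?; _×-dec_)
open import Relation.Unary using (Pred; Decidable)

-- Counting in lists

private variable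
  A B C : Set

# : {P : Pred A 0ℓ} → Decidable P → List A → ℕ
# P? xs = length (filter P? xs)

indicator : ∀ {P : Set} → Dec P → ℕ
indicator (yes _) = 1
indicator (no _)  = 0

indicator-mono : ∀ {P Q : Set} (p : Dec P) (q : Dec Q) → (P → Q) → indicator p ≤ indicator q
indicator-mono (yes p) (yes q) h = ≤-refl
indicator-mono (yes p) (no ¬q) h = contradiction (h p) ¬q
indicator-mono (no ¬p) _       h = z≤n

module _ {P : Pred A 0ℓ} (P? : Decidable P) where

  #-∷ : ∀ x xs → # P? (x ∷ xs) ≡ indicator (P? x) + # P? xs
  #-∷ x xs with P? x
  ... | yes _ = refl
  ... | no _  = refl

  #-∁ : ∀ xs → # P? xs + # (¬? ∘ P?) xs ≡ length xs
  #-∁ [] = refl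
  #-∁ (x ∷ xs) with #-∁ xs | P? x
  ... | ih | yes _ = cong suc ih
  ... | ih | no _  = trans (+-suc _ _) (cong suc ih)

  #-map : (f : B → A) → ∀ xs → # P? (map f xs) ≡ # (P? ∘ f) xs
  #-map f [] = refl
  #-map f (x ∷ xs) with P? (f x)
  ... | yes _ = cong suc (#-map f xs)
  ... | no _  = #-map f xs

  #-++ : ∀ xs ys → # P? (xs ++ ys) ≡ # P? xs + # P? ys
  #-++ xs ys = trans (cong length (filter-++ P? xs ys)) (length-++ (filter P? xs))

  #-none : ∀ xs → (∀ x → ¬ P x) → # P? xs ≡ 0
  #-none xs ¬p = cong length (filter-none P? (All.universal ¬p xs))

  #-unique : (∀ {x y} → P x → P y → x ≡ y) → ∀ {xs} → Unique xs → # P? xs ≤ 1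
  #-unique inj [] = z≤n
  #-unique inj (_∷_ {x} {xs} x∉ u) with P? x
  ... | no _  = #-unique inj u
  ... | yes p = s≤s (≤-reflexive (cong length (filter-none P? (All.map (λ x≢y q → x≢y (inj p q)) x∉))))

  #-rows : (f : B → C → A) → ∀ {c} ys → (∀ x → # P? (map (f x) ys) ≤ c) →
           ∀ xs → # P? (cartesianProductWith f xs ys) ≤ length xs * c
  #-rows f ys h [] = z≤n
  #-rows f ys h (x ∷ xs) =
    ≤-trans (≤-reflexive (#-++ (map (f x) ys) _)) (+-mono-≤ (h x) (#-rows f ys h xs))

module _ {P Q : Pred A 0ℓ} (P? : Decidable P) (Q? : Decidable Q) where

  #-mono : ∀ xs → (∀ {x} → x ∈ xs → P x → Q x) → # P? xs ≤ # Q? xs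
  #-mono [] h = z≤n
  #-mono (x ∷ xs) h with #-mono xs (h ∘ there) | P? x | Q? x
  ... | ih | yes _ | yes _ = s≤s ih
  ... | ih | yes p | no ¬q = contradiction (h (here refl) p) ¬q
  ... | ih | no _  | yes _ = m≤n⇒m≤1+n ih
  ... | ih | no _  | no _  = ih

  #-filter : ∀ xs → # P? (filter Q? xs) ≡ # (λ x → Q? x ×-dec P? x) xs
  #-filter [] = refl
  #-filter (x ∷ xs) with Q? x
  ... | no _ = #-filter xs
  ... | yes _ with P? x
  ...   | yes _ = cong suc (#-filter xs)
  ...   | no _ = #-filter xs

module _ {P Q R : Pred A 0ℓ} (P? : Decidable P) (Q? : Decidable Q) (R? : Decidable R) where

  #-∪ : (∀ {x} → P x → Q x ⊎ R x) → ∀ xs → # P? xs ≤ # Q? xs + # R? xs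
  #-∪ h xs = begin
    # P? xs                                               ≡⟨ #-∁ Q? (filter P? xs) ⟨
    # Q? (filter P? xs) + # (¬? ∘ Q?) (filter P? xs)      ≡⟨ cong₂ _+_ (#-filter Q? P? xs) (#-filter (¬? ∘ Q?) P? xs) ⟩
    # (λ x → P? x ×-dec Q? x) xs + # (λ x → P? x ×-dec ¬? (Q? x)) xs
      ≤⟨ +-mono-≤ (#-mono _ Q? xs (λ _ → proj₂))
                  (#-mono _ R? xs (λ _ (p , ¬q) → fromInj₂ (λ q → contradiction q ¬q) (h p))) ⟩
    # Q? xs + # R? xs                                     ∎
    where open ≤-Reasoning

module _ {P : Pred A 0ℓ} {Q : Pred B 0ℓ} {R : Pred C 0ℓ}
         (P? : Decidable P) (Q? : Decidable Q) (R? : Decidable R)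
         (f : A → B → C) (h : ∀ {x y} → R (f x y) → P x × Q y) where

  #-product : ∀ xs ys → # R? (cartesianProductWith f xs ys) ≤ # P? xs * # Q? ys
  #-product [] ys = z≤n
  #-product (x ∷ xs) ys = ≤-trans (≤-reflexive (#-++ R? (map (f x) ys) _)) step
    where
    row : # R? (map (f x) ys) ≤ # Q? ys
    row = ≤-trans (≤-reflexive (#-map R? (f x) ys)) (#-mono (R? ∘ f x) Q? ys (λ _ → proj₂ ∘ h))
    none : ¬ P x → # R? (map (f x) ys) ≡ 0
    none ¬p = trans (#-map R? (f x) ys) (#-none (R? ∘ f x) ys (λ _ → ¬p ∘ proj₁ ∘ h))
    step : # R? (map (f x) ys) + # R? (cartesianProductWith f xs ys) ≤ # P? (x ∷ xs) * # Q? ys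
    step with P? x
    ... | yes _ = +-mono-≤ row (#-product xs ys)
    ... | no ¬p = ≤-trans (≤-reflexive (cong (_+ _) (none ¬p))) (#-product xs ys)

length-product : (f : A → B → C) → ∀ xs ys →
                 length (cartesianProductWith f xs ys) ≡ length xs * length ys
length-product f [] ys = refl
length-product f (x ∷ xs) ys =
  trans (length-++ (map (f x) ys)) (cong₂ _+_ (length-map (f x) ys) (length-product f xs ys))

-- A union bound with denominators cleared: each `x` rules out at most `N / M` members of `ys`.
-- Deleting those ruled out by the first `x` costs `N` on the left of the strict inequality and at
-- most `N` on the right.
avoid : ∀ {R : A → B → Set} (R? : ∀ x → Decidable (R x)) {M N} (xs : List A) (ys : List B) →
        (∀ x → # (R? x) ys * M ≤ N) → length xs * N < length ys * M →
        ∃[ y ] y ∈ ys × All (λ x → ¬ R x y) xs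
avoid R? [] (y ∷ ys) h lt = y , here refl , []
avoid R? {M} {N} (x ∷ xs) ys h lt with avoid R? xs (filter (¬? ∘ R? x) ys) h′ lt′
  where
  open ≤-Reasoning
  h′ : ∀ z → # (R? z) (filter (¬? ∘ R? x) ys) * M ≤ N
  h′ z = begin
    # (R? z) (filter (¬? ∘ R? x) ys) * M          ≡⟨ cong (_* M) (#-filter (R? z) (¬? ∘ R? x) ys) ⟩
    # (λ y → ¬? (R? x y) ×-dec R? z y) ys * M     ≤⟨ *-monoˡ-≤ M (#-mono _ (R? z) ys (λ _ → proj₂)) ⟩
    # (R? z) ys * M                               ≤⟨ h z ⟩
    N                                             ∎
  lt′ : length xs * N < # (¬? ∘ R? x) ys * M
  lt′ = +-cancelˡ-< N _ _ (begin-strict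
    N + length xs * N                             <⟨ lt ⟩
    length ys * M                                 ≡⟨ cong (_* M) (#-∁ (R? x) ys) ⟨
    (# (R? x) ys + # (¬? ∘ R? x) ys) * M          ≡⟨ *-distribʳ-+ M (# (R? x) ys) _ ⟩
    # (R? x) ys * M + # (¬? ∘ R? x) ys * M        ≤⟨ +-monoˡ-≤ _ (h x) ⟩
    N + # (¬? ∘ R? x) ys * M                      ∎)
... | y , y∈ , ok with ∈-filter⁻ (¬? ∘ R? x) {xs = ys} y∈
...   | y∈ys , ¬r = y , y∈ys , ¬r ∷ ok

-- Choosing signs

Assignment : Set
Assignment = ℕ → Bool

satLit? : ∀ v b → Decidable (λ σ → SatLit σ (v , b))
satLit? v b σ = σ v Bool.≟ b

satClause? : ∀ C → Decidable (λ σ → SatClause σ C)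
satClause? C σ = Any.any? (λ l → satLit? (proj₁ l) (proj₂ l) σ) C

satFormula? : ∀ F → Decidable (λ σ → All (SatClause σ) F)
satFormula? F σ = All.all? (λ C → satClause? C σ) F

majority : ∀ v (L : List Assignment) → ∃[ b ] length L ≤ 2 * # (satLit? v b) L
majority v L with ≤-total (# (satLit? v false) L) (# (satLit? v true) L)
... | inj₁ f≤t = true , ≤-trans two-values (+-monoʳ-≤ _ (≤-trans f≤t (m≤m+n _ 0)))
  where
  two-values : length L ≤ # (satLit? v true) L + # (satLit? v false) L
  two-values = ≤-trans (≤-reflexive (sym (#-∁ (satLit? v true) L)))
    (+-monoʳ-≤ _ (#-mono _ (satLit? v false) L (λ _ → Bool.¬-not)))
... | inj₂ t≤f = false , ≤-trans two-values (+-monoʳ-≤ _ (≤-trans t≤f (m≤m+n _ 0)))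
  where
  two-values : length L ≤ # (satLit? v false) L + # (satLit? v true) L
  two-values = ≤-trans (≤-reflexive (sym (#-∁ (satLit? v false) L)))
    (+-monoʳ-≤ _ (#-mono _ (satLit? v true) L (λ _ → Bool.¬-not)))

-- Each variable gets the sign opposed to its commoner value among the assignments in `L` that
-- falsify the literals before it. At least half of those falsify the new literal too, so each
-- variable costs at most a factor 2.
falsify-many : ∀ vs (L : List Assignment) → ∃[ C ] vars C ≡ vs ×
               length L ≤ 2 ^ length vs * # (¬? ∘ satClause? C) L
falsify-many [] L = [] , refl , ≤-reflexive (sym (trans (*-identityˡ _) all-falsified))
  where
  all-falsified : # (¬? ∘ satClause? []) L ≡ length L
  all-falsified = trans
    (sym (cong (_+ # (¬? ∘ satClause? []) L) (#-none (satClause? []) L (λ _ ()))))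
    (#-∁ (satClause? []) L)
falsify-many (v ∷ vs) L
  with b , most ← majority v L
  with C , refl , many ← falsify-many vs (filter (satLit? v b) L) = (v , not b) ∷ C , refl , (begin
    length L
      ≤⟨ most ⟩
    2 * # (satLit? v b) L
      ≤⟨ *-monoʳ-≤ 2 many ⟩
    2 * (2 ^ n * # (¬? ∘ satClause? C) (filter (satLit? v b) L))
      ≡⟨ *-assoc 2 (2 ^ n) _ ⟨
    2 ^ suc n * # (¬? ∘ satClause? C) (filter (satLit? v b) L)
      ≡⟨ cong (2 ^ suc n *_) (#-filter (¬? ∘ satClause? C) (satLit? v b) L) ⟩
    2 ^ suc n * # (λ σ → satLit? v b σ ×-dec ¬? (satClause? C σ)) L
      ≤⟨ *-monoʳ-≤ (2 ^ suc n) (#-mono _ (¬? ∘ satClause? ((v , not b) ∷ C)) L λ _ → λ where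
           (σv≡b , ¬sat) (here σv≡¬b) → Bool.not-¬ refl (trans (sym σv≡b) σv≡¬b)
           (σv≡b , ¬sat) (there sat) → ¬sat sat) ⟩
    2 ^ suc n * # (¬? ∘ satClause? ((v , not b) ∷ C)) L          ∎)
  where
  open ≤-Reasoning
  n = length (vars C)

*-swap : ∀ a b c → a * (b * c) ≡ b * (a * c)
*-swap = solve-∀

-- `u` counts the assignments that a clause falsifies, `s` the survivors and `l` both together, with
-- `suc j` in the role of `2 ^ k`.
survivors-bound : ∀ j {s u l} → u + s ≡ l → l ≤ suc j * u → suc j * s ≤ j * l
survivors-bound j {s} {u} {l} refl l≤ = +-cancelˡ-≤ l _ _ (begin
  l + suc j * s          ≤⟨ +-monoˡ-≤ _ l≤ ⟩
  suc j * u + suc j * s  ≡⟨ *-distribˡ-+ (suc j) u s ⟨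
  suc j * l              ∎)
  where open ≤-Reasoning

-- Each clause is chosen against the survivors of the clauses before it and leaves at most the
-- fraction `j / suc j` of them. Writing `2 ^ k` as `suc j` expresses the factor `1 - 2^-k` in
-- natural numbers.
choose-signs : ∀ {k j} → 2 ^ k ≡ suc j → ∀ W → All (λ vs → length vs ≡ k) W → (L : List Assignment) →
               ∃[ F ] map vars F ≡ W ×
                 # (satFormula? F) L * suc j ^ length W ≤ j ^ length W * length L
choose-signs eq [] [] L =
  [] , refl , ≤-trans (≤-reflexive (*-identityʳ _))
                (≤-trans (length-filter (satFormula? []) L) (≤-reflexive (sym (*-identityˡ _))))
choose-signs {k} {j} eq (vs ∷ W) (refl ∷ lengths) L
  with C , refl , many ← falsify-many vs L
  with F , refl , few ← choose-signs eq W lengths (filter (satClause? C) L) = C ∷ F , refl , (begin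
    # (satFormula? (C ∷ F)) L * (suc j * suc j ^ t)
      ≤⟨ *-monoˡ-≤ _ (#-mono _ (λ σ → satClause? C σ ×-dec satFormula? F σ) L λ _ → λ where
           (c ∷ f) → c , f) ⟩
    # (λ σ → satClause? C σ ×-dec satFormula? F σ) L * (suc j * suc j ^ t)
      ≡⟨ cong (_* (suc j * suc j ^ t)) (#-filter (satFormula? F) (satClause? C) L) ⟨
    # (satFormula? F) L′ * (suc j * suc j ^ t)   ≡⟨ *-swap (# (satFormula? F) L′) (suc j) _ ⟩
    suc j * (# (satFormula? F) L′ * suc j ^ t)   ≤⟨ *-monoʳ-≤ (suc j) few ⟩
    suc j * (j ^ t * length L′)                  ≡⟨ *-swap (suc j) (j ^ t) _ ⟩
    j ^ t * (suc j * length L′)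
      ≤⟨ *-monoʳ-≤ (j ^ t) (survivors-bound j (trans (+-comm _ (length L′)) (#-∁ (satClause? C) L))
           (≤-trans many (≤-reflexive (cong (_* # (¬? ∘ satClause? C) L) eq)))) ⟩
    j ^ t * (j * length L)                       ≡⟨ *-swap (j ^ t) j _ ⟩
    j * (j ^ t * length L)                       ≡⟨ *-assoc j (j ^ t) _ ⟨
    j * j ^ t * length L                         ∎)
  where
  open ≤-Reasoning
  L′ = filter (satClause? C) L
  t = length (map vars F)

-- Finitely many representative assignments

extend : Bool → Assignment → Assignment
extend b σ zero    = b
extend b σ (suc v) = σ v

-- One representative for each pattern of values on the variables below `n`; all other variables are
-- false.
assignments : ℕ → List Assignment
assignments zero    = (λ _ → false) ∷ []
assignments (suc n) = cartesianProductWith extend (false ∷ true ∷ []) (assignments n)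

length-assignments : ∀ n → length (assignments n) ≡ 2 ^ n
length-assignments zero    = refl
length-assignments (suc n) =
  trans (length-product extend (false ∷ true ∷ []) (assignments n)) (cong (2 *_) (length-assignments n))

assignments-complete : ∀ n (σ : Assignment) → ∃[ τ ] τ ∈ assignments n × (∀ {v} → v < n → τ v ≡ σ v)
assignments-complete zero σ = (λ _ → false) , here refl , λ ()
assignments-complete (suc n) σ with assignments-complete n (σ ∘ suc)
... | τ , τ∈ , agrees = extend (σ 0) τ , ∈-cartesianProductWith⁺ extend (bool∈ (σ 0)) τ∈ , extend-agrees
  where
  extend-agrees : ∀ {v} → v < suc n → extend (σ 0) τ v ≡ σ v
  extend-agrees {zero}  _         = refl
  extend-agrees {suc v} (s≤s v<n) = agrees v<n
  bool∈ : ∀ b → b ∈ false ∷ true ∷ []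
  bool∈ false = here refl
  bool∈ true  = there (here refl)

satClause-cong : ∀ {σ τ : Assignment} {n} → (∀ {v} → v < n → τ v ≡ σ v) →
                 ∀ {C} → All (_< n) (vars C) → SatClause σ C → SatClause τ C
satClause-cong agrees (v<n ∷ _) (here sat)  = here (trans (agrees v<n) sat)
satClause-cong agrees (_ ∷ vs)  (there sat) = there (satClause-cong agrees vs sat)

-- A satisfying assignment could be replaced by its representative, which agrees with it on every
-- variable that occurs and would therefore be a survivor.
no-survivors⇒unsat : ∀ n F → All (All (_< n)) (map vars F) →
                     # (satFormula? F) (assignments n) ≡ 0 → Unsatisfiable F
no-survivors⇒unsat n F bounded none (σ , sat)
  with τ , τ∈ , agrees ← assignments-complete n σ =
  contradiction none (m<n⇒n≢0 (∈-length (∈-filter⁺ (satFormula? F) τ∈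
    (All.zipWith (λ (vs , s) → satClause-cong agrees vs s) (All.map⁻ bounded , sat)))))

-- Bernoulli's inequality and the number of clauses

bernoulli : ∀ j t → (t + j) * j ^ t ≤ j * suc j ^ t
bernoulli j zero    = ≤-refl
bernoulli j (suc t) = begin
  (suc t + j) * (j * j ^ t)   ≡⟨ *-assoc (suc t + j) j (j ^ t) ⟨
  (suc t + j) * j * j ^ t     ≤⟨ *-monoˡ-≤ (j ^ t) (≤-trans (m≤m+n _ t) (≤-reflexive (expand t j))) ⟩
  suc j * (t + j) * j ^ t     ≡⟨ *-assoc (suc j) (t + j) (j ^ t) ⟩
  suc j * ((t + j) * j ^ t)   ≤⟨ *-monoʳ-≤ (suc j) (bernoulli j t) ⟩
  suc j * (j * suc j ^ t)     ≡⟨ *-swap (suc j) j _ ⟩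
  j * (suc j * suc j ^ t)     ∎
  where
  open ≤-Reasoning
  expand : ∀ t j → (1 + t + j) * j + t ≡ (1 + j) * (t + j)
  expand = solve-∀

-- This is `(1 - 1/(j+1))^(j+1) < 1/2`: Bernoulli's inequality with `t = j` gives the factor 2, and
-- `j < suc j` makes it strict.
halving : ∀ j .{{_ : NonZero j}} → 2 * j ^ suc j < suc j ^ suc j
halving j = begin-strict
  2 * (j * j ^ j)    ≡⟨ regroup j (j ^ j) ⟩
  (j + j) * j ^ j    ≤⟨ bernoulli j j ⟩
  j * suc j ^ j      <⟨ m<n+m _ (m^n>0 (suc j) j) ⟩
  suc j * suc j ^ j  ∎
  where
  open ≤-Reasoning
  regroup : ∀ a b → 2 * (a * b) ≡ (a + a) * b
  regroup = solve-∀

^-distribʳ-* : ∀ n a b → (a * b) ^ n ≡ a ^ n * b ^ n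
^-distribʳ-* zero    a b = refl
^-distribʳ-* (suc n) a b = trans (cong (a * b *_) (^-distribʳ-* n a b)) (regroup a b (a ^ n) (b ^ n))
  where
  regroup : ∀ a b c d → a * b * (c * d) ≡ a * c * (b * d)
  regroup = solve-∀

-- Every `suc j` clauses more than halve the bound on the survivors, so `n` such rounds bring
-- `2 ^ n` assignments below one.
halving-rounds : ∀ j n .{{_ : NonZero j}} .{{_ : NonZero n}} →
                 j ^ (suc j * n) * 2 ^ n < suc j ^ (suc j * n)
halving-rounds j n = begin-strict
  j ^ (suc j * n) * 2 ^ n   ≡⟨ cong (_* 2 ^ n) (^-*-assoc j (suc j) n) ⟨
  (j ^ suc j) ^ n * 2 ^ n   ≡⟨ *-comm ((j ^ suc j) ^ n) (2 ^ n) ⟩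
  2 ^ n * (j ^ suc j) ^ n   ≡⟨ ^-distribʳ-* n 2 (j ^ suc j) ⟨
  (2 * j ^ suc j) ^ n       <⟨ ^-monoˡ-< n (halving j) ⟩
  (suc j ^ suc j) ^ n       ≡⟨ ^-*-assoc (suc j) (suc j) n ⟩
  suc j ^ (suc j * n)       ∎
  where open ≤-Reasoning

unsat-signs : ∀ k n .{{_ : NonZero k}} .{{_ : NonZero n}} W → All (λ vs → length vs ≡ k) W →
              All (All (_< n)) W → length W ≡ 2 ^ k * n → ∃[ F ] map vars F ≡ W × Unsatisfiable F
unsat-signs k@(suc k′) n W lengths bounded many
  -- `k ≥ 1` makes `j` positive, as `halving-rounds` requires.
  with j ← 2 ^ k ∸ 1
     | eq ← sym (m+[n∸m]≡n (m^n>0 2 k))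
     | j>0 ← m<n⇒0<n∸m (^-monoʳ-< 2 ≤-refl {0} {k} (s≤s z≤n))
  with F , refl , few ← choose-signs eq W lengths (assignments n) =
  -- The number of survivors times `suc j ^ m` is less than `suc j ^ m`, so that number is 0.
  F , refl , no-survivors⇒unsat n F bounded (n<1⇒n≡0 (*-cancelʳ-< (suc j ^ m) _ _ (begin-strict
    # (satFormula? F) (assignments n) * suc j ^ m   ≤⟨ few ⟩
    j ^ m * length (assignments n)                  ≡⟨ cong (j ^ m *_) (length-assignments n) ⟩
    j ^ m * 2 ^ n                                   ≡⟨ cong (λ e → j ^ e * 2 ^ n) rounds ⟩
    j ^ (suc j * n) * 2 ^ n                         <⟨ halving-rounds j n {{>-nonZero j>0}} ⟩
    suc j ^ (suc j * n)                             ≡⟨ cong (suc j ^_) rounds ⟨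
    suc j ^ m                                       ≡⟨ *-identityˡ _ ⟨
    1 * suc j ^ m                                   ∎)))
  where
  open ≤-Reasoning
  m = length (map vars F)
  rounds : m ≡ suc j * n
  rounds = trans many (cong (_* n) eq)

sharedVars : List ℕ → List ℕ → ℕ
sharedVars U V = # (_∈? V) U

-- Words and their shifts

module Words (q : ℕ) .{{_ : NonZero q}} where

  infixl 6 _⊕_

  _⊕_ : Fin q → Fin q → Fin q
  x ⊕ y = (toℕ x + toℕ y) mod q

  _⊖_ : Fin q → Fin q → Fin q
  x ⊖ y = (toℕ x + (q ∸ toℕ y)) mod q

  -- By this rule modulo `q` the comparison of two shifted letters becomes that of one shifted
  -- letter with an unshifted one.
  ⊕-transpose : ∀ {x c y d} → x ⊕ c ≡ y ⊕ d → y ⊕ (d ⊖ c) ≡ x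
  ⊕-transpose {x} {c} {y} {d} eq = toℕ-injective (begin
    toℕ (y ⊕ (d ⊖ c))                              ≡⟨ toℕ-fromℕ< _ ⟩
    (toℕ y + toℕ (d ⊖ c)) % q                      ≡⟨ cong (λ z → (toℕ y + z) % q) (toℕ-fromℕ< (m%n<n (toℕ d + c′) q)) ⟩
    (toℕ y + (toℕ d + c′) % q) % q                 ≡⟨ %-+ʳ (toℕ y) (toℕ d + c′) ⟩
    (toℕ y + (toℕ d + c′)) % q                     ≡⟨ cong (_% q) (+-assoc (toℕ y) (toℕ d) c′) ⟨
    (toℕ y + toℕ d + c′) % q                       ≡⟨ %-+ˡ (toℕ y + toℕ d) c′ ⟨
    ((toℕ y + toℕ d) % q + c′) % q                 ≡⟨ cong (λ z → (z + c′) % q) eq′ ⟨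
    ((toℕ x + toℕ c) % q + c′) % q                 ≡⟨ %-+ˡ (toℕ x + toℕ c) c′ ⟩
    (toℕ x + toℕ c + c′) % q                       ≡⟨ cong (_% q) (+-assoc (toℕ x) (toℕ c) c′) ⟩
    (toℕ x + (toℕ c + c′)) % q                     ≡⟨ cong (λ z → (toℕ x + z) % q) (m+[n∸m]≡n (toℕ≤n c)) ⟩
    (toℕ x + q) % q                                ≡⟨ [m+n]%n≡m%n (toℕ x) q ⟩
    toℕ x % q                                      ≡⟨ m<n⇒m%n≡m (toℕ<n x) ⟩
    toℕ x                                          ∎)
    where
    open ≡-Reasoning
    c′ = q ∸ toℕ c
    eq′ : (toℕ x + toℕ c) % q ≡ (toℕ y + toℕ d) % q
    eq′ = trans (sym (toℕ-fromℕ< _)) (trans (cong toℕ eq) (toℕ-fromℕ< _))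
    %-+ʳ : ∀ a b → (a + b % q) % q ≡ (a + b) % q
    %-+ʳ a b = trans (%-distribˡ-+ a (b % q) q)
      (trans (cong (λ z → (a % q + z) % q) (m%n%n≡m%n b q)) (sym (%-distribˡ-+ a b q)))
    %-+ˡ : ∀ a b → (a % q + b) % q ≡ (a + b) % q
    %-+ˡ a b = trans (cong (_% q) (+-comm (a % q) b)) (trans (%-+ʳ b a) (cong (_% q) (+-comm b a)))

  ⊕-comm : ∀ x y → x ⊕ y ≡ y ⊕ x
  ⊕-comm x y = cong (_mod q) (+-comm (toℕ x) (toℕ y))

  ⊕-cancelˡ : ∀ {x c d} → x ⊕ c ≡ x ⊕ d → c ≡ d
  -- Both `c` and `d` equal `d ⊕ (x ⊖ x)`.
  ⊕-cancelˡ {x} {c} {d} eq = trans (sym (⊕-transpose (trans (⊕-comm c x) (trans eq (⊕-comm x d)))))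
                                   (⊕-transpose {d} {x} {d} {x} refl)

  Word : ℕ → Set
  Word = Vec (Fin q)

  private variable
    k : ℕ

  shift : Word k → Fin q → Word k
  shift w c = Vec.map (_⊕ c) w

  -- This is `k` minus the Hamming distance.
  agree : Word k → Word k → ℕ
  agree []      []      = 0
  agree (x ∷ v) (y ∷ w) = indicator (x ≟ y) + agree v w

  agree-sym : ∀ (v w : Word k) → agree v w ≤ agree w v
  agree-sym []      []      = z≤n
  agree-sym (x ∷ v) (y ∷ w) = +-mono-≤ (indicator-mono (x ≟ y) (y ≟ x) sym) (agree-sym v w)

  -- Only the difference of the two shifts matters, which is why `Apart` shifts just one of its
  -- words.
  agree-shift : ∀ (v w : Word k) c d → agree (shift v c) (shift w d) ≤ agree (shift w (d ⊖ c)) v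
  agree-shift []      []      c d = z≤n
  agree-shift (x ∷ v) (y ∷ w) c d =
    +-mono-≤ (indicator-mono (x ⊕ c ≟ y ⊕ d) (y ⊕ (d ⊖ c) ≟ x) ⊕-transpose) (agree-shift v w c d)

  agree-orbit : ∀ (w : Word k) {c d} → c ≢ d → agree (shift w c) (shift w d) ≡ 0
  agree-orbit []      c≢d = refl
  agree-orbit (x ∷ w) {c} {d} c≢d with x ⊕ c ≟ x ⊕ d
  ... | yes eq = contradiction (⊕-cancelˡ eq) c≢d
  ... | no _   = agree-orbit w c≢d

  agree-cons : ∀ {a} (x y : Fin q) (v w : Word k) → suc a ≤ agree (x ∷ v) (y ∷ w) →
               (x ≡ y × a ≤ agree v w) ⊎ suc a ≤ agree v w
  agree-cons x y v w le with x ≟ y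
  ... | yes x≡y = inj₁ (x≡y , ℕ.s≤s⁻¹ le)
  ... | no _    = inj₂ le

  -- Counting words close to a given word

  words : ∀ k → List (Word k)
  words zero    = [] ∷ []
  words (suc k) = cartesianProductWith _∷_ (allFin q) (words k)

  length-allFin : length (allFin q) ≡ q
  length-allFin = length-tabulate {n = q} id

  length-words : ∀ k → length (words k) ≡ q ^ k
  length-words zero    = refl
  length-words (suc k) =
    trans (length-product _∷_ (allFin q) (words k)) (cong₂ _*_ length-allFin (length-words k))

  -- Choosing `a` positions of agreement in at most `k^a` ways leaves `q^(k-a)` words each; `q ^ a`
  -- is moved to the left. In the recursion, a word with `suc a` agreements either matches the first
  -- letter and has `a` agreements in the rest, or has `suc a` in the rest.
  ball-bound : ∀ a (h : Word k) → # (λ w → a ≤? agree h w) (words k) * q ^ a ≤ k ^ a * q ^ k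
  ball-bound {k} zero h = begin
    # (λ w → 0 ≤? agree h w) (words k) * 1   ≡⟨ *-identityʳ _ ⟩
    # (λ w → 0 ≤? agree h w) (words k)       ≤⟨ length-filter (λ w → 0 ≤? agree h w) (words k) ⟩
    length (words k)                         ≡⟨ length-words k ⟩
    q ^ k                                    ≡⟨ *-identityˡ _ ⟨
    1 * q ^ k                                ∎
    where open ≤-Reasoning
  ball-bound (suc a) [] = z≤n
  ball-bound {suc k} (suc a) (x ∷ v) = begin
    # (λ w → suc a ≤? agree (x ∷ v) w) (words (suc k)) * q ^ suc a
      ≤⟨ *-monoˡ-≤ (q ^ suc a) split ⟩
    (near a + q * near (suc a)) * (q * q ^ a)
      ≡⟨ expand (near a) q (near (suc a)) (q ^ a) ⟩
    q * (near a * q ^ a + q * (near (suc a) * q ^ a))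
      ≡⟨ cong (λ z → q * (near a * q ^ a + z)) (*-swap q (near (suc a)) (q ^ a)) ⟩
    q * (near a * q ^ a + near (suc a) * q ^ suc a)
      ≤⟨ *-monoʳ-≤ q (+-mono-≤ (ball-bound a v) (ball-bound (suc a) v)) ⟩
    q * (k ^ a * q ^ k + k ^ suc a * q ^ k)
      -- `k ^ a + k ^ suc a` is `suc k * k ^ a`, which is at most `suc k ^ suc a`.
      ≡⟨ collect q (k ^ a) (q ^ k) k ⟩
    suc k * k ^ a * q ^ suc k
      ≤⟨ *-monoˡ-≤ (q ^ suc k) (*-monoʳ-≤ (suc k) (^-monoˡ-≤ a (n≤1+n k))) ⟩
    suc k ^ suc a * q ^ suc k ∎
    where
    open ≤-Reasoning
    near : ℕ → ℕ
    near b = # (λ w → b ≤? agree v w) (words k)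
    Head? : Decidable (λ w → x ≡ Vec.head w × a ≤ agree v (Vec.tail w))
    Head? w = (x ≟ Vec.head w) ×-dec (a ≤? agree v (Vec.tail w))
    Tail? : Decidable (λ w → suc a ≤ agree v (Vec.tail w))
    Tail? w = suc a ≤? agree v (Vec.tail w)
    tails : ∀ y → # Tail? (map (y ∷_) (words k)) ≤ near (suc a)
    tails y = ≤-reflexive (#-map Tail? (y ∷_) (words k))
    heads : # Head? (words (suc k)) ≤ near a
    heads = begin
      # Head? (words (suc k))
        ≤⟨ #-product (x ≟_) (λ w → a ≤? agree v w) Head? _∷_ id (allFin q) (words k) ⟩
      # (x ≟_) (allFin q) * near a
        ≤⟨ *-monoˡ-≤ (near a) (#-unique (x ≟_) (λ p r → trans (sym p) r) (allFin⁺ q)) ⟩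
      1 * near a
        ≡⟨ *-identityˡ _ ⟩
      near a ∎
    split : # (λ w → suc a ≤? agree (x ∷ v) w) (words (suc k)) ≤ near a + q * near (suc a)
    split = begin
      # (λ w → suc a ≤? agree (x ∷ v) w) (words (suc k))
        ≤⟨ #-∪ _ Head? Tail? (λ {w} → decompose w) (words (suc k)) ⟩
      # Head? (words (suc k)) + # Tail? (words (suc k))
        ≤⟨ +-mono-≤ heads (#-rows Tail? _∷_ (words k) tails (allFin q)) ⟩
      near a + length (allFin q) * near (suc a)
        ≡⟨ cong (λ m → near a + m * near (suc a)) length-allFin ⟩
      near a + q * near (suc a) ∎
      where
      decompose : ∀ w → suc a ≤ agree (x ∷ v) w →
                  (x ≡ Vec.head w × a ≤ agree v (Vec.tail w)) ⊎ suc a ≤ agree v (Vec.tail w)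
      decompose (y ∷ w) = agree-cons x y v w
    expand : ∀ n q m p → (n + q * m) * (q * p) ≡ q * (n * p + q * (m * p))
    expand = solve-∀
    collect : ∀ q p r k → q * (p * r + k * p * r) ≡ (1 + k) * p * (q * r)
    collect = solve-∀

  -- Words that stay apart under all shifts

  Apart : ℕ → Word k → Word k → Set
  Apart α g f = ∀ c → agree (shift f c) g ≤ α

  orbits : List (Word k) → List (Word k)
  orbits S = cartesianProductWith shift S (allFin q)

  length-orbits : ∀ (S : List (Word k)) → length (orbits S) ≡ length S * q
  length-orbits S = trans (length-product shift S (allFin q)) (cong (length S *_) length-allFin)

  -- A ball takes at most the fraction `(k / q)^(α+1)` of the space, so `length S * q` balls take at
  -- most `length S * k ^ suc α / q ^ α`, which is below 1. The form is that of the hypothesis of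
  -- `avoid`.
  uncrowded : ∀ {α} (S : List (Word k)) → length S * k ^ suc α < q ^ α →
              length (orbits S) * (k ^ suc α * q ^ k) < length (words k) * q ^ suc α
  uncrowded {k} {α} S room = begin-strict
    length (orbits S) * (k ^ suc α * q ^ k)   ≡⟨ cong (_* (k ^ suc α * q ^ k)) (length-orbits S) ⟩
    length S * q * (k ^ suc α * q ^ k)        ≡⟨ regroup (length S) q (k ^ suc α) (q ^ k) ⟩
    q ^ suc k * (length S * k ^ suc α)        <⟨ *-monoʳ-< (q ^ suc k) {{m^n≢0 q (suc k)}} room ⟩
    q ^ suc k * q ^ α                         ≡⟨ regroup′ q (q ^ k) (q ^ α) ⟩
    q ^ k * q ^ suc α                         ≡⟨ cong (_* q ^ suc α) (length-words k) ⟨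
    length (words k) * q ^ suc α              ∎
    where
    open ≤-Reasoning
    regroup : ∀ s q p r → s * q * (p * r) ≡ q * r * (s * p)
    regroup = solve-∀
    regroup′ : ∀ q r p → q * r * p ≡ r * (q * p)
    regroup′ = solve-∀

  -- Gilbert–Varshamov: as long as the balls around all shifts of the words chosen so far do
  -- not cover the space, a further word can be added.
  next-apart : ∀ {α} (S : List (Word k)) → length S * k ^ suc α < q ^ α →
               ∃[ g ] All (Apart α g) S
  next-apart {k} {α} S room
    with g , _ , far ← avoid (λ h w → suc α ≤? agree h w) (orbits S) (words k)
                         (ball-bound (suc α)) (uncrowded {α = α} S room) =
    g , All.tabulate (λ f∈S c → ≮⇒≥ (All.lookup far (∈-cartesianProductWith⁺ shift f∈S (∈-allFin c))))

  apart-words : ∀ {α} s → s * k ^ suc α < q ^ α → ∃[ S ] length S ≡ s × AllPairs (Apart {k} α) S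
  apart-words zero _ = [] , refl , []
  apart-words {k} {α} (suc s) room
    with room′ ← ≤-<-trans (*-monoˡ-≤ (k ^ suc α) (n≤1+n s)) room
    with S , refl , apart ← apart-words {k} {α} s room′
    with g , g-apart ← next-apart {k} {α} S room′ = g ∷ S , refl , g-apart ∷ apart

  -- Two shifts of one word agree nowhere; shifts of two different chosen words are reduced by
  -- `agree-shift` to the condition `Apart`.
  orbits-agree : ∀ {α} {S : List (Word k)} → AllPairs (Apart α) S →
                 AllPairs (λ v w → agree v w ≤ α) (orbits S)
  orbits-agree [] = []
  orbits-agree {α = α} {g ∷ S} (g-apart ∷ apart) = AllPairs.++⁺
    (AllPairs.map⁺ (AllPairs.map (λ c≢d → ≤-trans (≤-reflexive (agree-orbit g c≢d)) z≤n) (allFin⁺ q)))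
    (orbits-agree apart)
    (All.map⁺ (All.universal (λ c → All.tabulate (across c)) (allFin q)))
    where
    across : ∀ c {w} → w ∈ orbits S → agree (shift g c) w ≤ α
    across c w∈ with f , d , f∈S , _ , refl ← ∈-cartesianProductWith⁻ shift S (allFin q) w∈ =
      ≤-trans (agree-shift g f c d) (All.lookup g-apart f∈S (d ⊖ c))

  -- At each of the `k` positions no more than one shift of `g` matches `v`.
  orbit-hits : ∀ (v g : Word k) → # (λ c → 1 ≤? agree v (shift g c)) (allFin q) ≤ k
  orbit-hits []      []      = ≤-reflexive (#-none (λ _ → 1 ≤? 0) (allFin q) (λ _ ()))
  orbit-hits {suc k} (x ∷ v) (y ∷ g) = begin
    # (λ c → 1 ≤? agree (x ∷ v) (shift (y ∷ g) c)) (allFin q)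
      ≤⟨ #-∪ _ (λ c → x ≟ y ⊕ c) (λ c → 1 ≤? agree v (shift g c)) (λ {c} → decompose c) (allFin q) ⟩
    # (λ c → x ≟ y ⊕ c) (allFin q) + # (λ c → 1 ≤? agree v (shift g c)) (allFin q)
      ≤⟨ +-mono-≤ (#-unique (λ c → x ≟ y ⊕ c) (λ p r → ⊕-cancelˡ (trans (sym p) r)) (allFin⁺ q)) (orbit-hits v g) ⟩
    suc k ∎
    where
    open ≤-Reasoning
    decompose : ∀ c → 1 ≤ agree (x ∷ v) (shift (y ∷ g) c) → x ≡ y ⊕ c ⊎ 1 ≤ agree v (shift g c)
    decompose c le with agree-cons x (y ⊕ c) v (shift g c) le
    ... | inj₁ (x≡ , _) = inj₁ x≡
    ... | inj₂ le′      = inj₂ le′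

  -- The bound does not involve `q`; it becomes the bound on the clause degree.
  orbits-hits : ∀ (v : Word k) S → # (λ w → 1 ≤? agree v w) (orbits S) ≤ length S * k
  orbits-hits v S = #-rows (λ w → 1 ≤? agree v w) shift (allFin q)
    (λ g → ≤-trans (≤-reflexive (#-map (λ w → 1 ≤? agree v w) (shift g) (allFin q))) (orbit-hits v g)) S

  -- The i-th letter y of a word becomes the variable i q + y, so that shared variables of two
  -- encoded words are positions where the words agree.
  encode : ℕ → Word k → List ℕ
  encode o []      = []
  encode o (x ∷ w) = o + toℕ x ∷ encode (o + q) w

  length-encode : ∀ o (w : Word k) → length (encode o w) ≡ k
  length-encode o []      = refl
  length-encode o (x ∷ w) = cong suc (length-encode (o + q) w)

  encode-≥ : ∀ o (w : Word k) → All (o ≤_) (encode o w)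
  encode-≥ o []      = []
  encode-≥ o (x ∷ w) = m≤m+n o _ ∷ All.map (≤-trans (m≤m+n o q)) (encode-≥ (o + q) w)

  encode-tail-> : ∀ o (x : Fin q) (w : Word k) → All (o + toℕ x <_) (encode (o + q) w)
  encode-tail-> o x w = All.map (<-≤-trans (+-monoʳ-< o (toℕ<n x))) (encode-≥ (o + q) w)

  encode-< : ∀ o (w : Word k) → All (_< o + k * q) (encode o w)
  encode-< o []      = []
  encode-< {suc k} o (x ∷ w) = +-monoʳ-< o (<-≤-trans (toℕ<n x) (m≤m+n q (k * q))) ∷
    subst (λ m → All (_< m) (encode (o + q) w)) (+-assoc o q (k * q)) (encode-< (o + q) w)

  encode-increasing : ∀ o (w : Word k) → AllPairs _<_ (encode o w)
  encode-increasing o []      = []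
  encode-increasing o (x ∷ w) = encode-tail-> o x w ∷ encode-increasing (o + q) w

  shared≤agree : ∀ o (v w : Word k) → sharedVars (encode o v) (encode o w) ≤ agree v w
  shared≤agree o []      []      = z≤n
  shared≤agree o (x ∷ v) (y ∷ w) = begin
    sharedVars (encode o (x ∷ v)) (encode o (y ∷ w))
      ≡⟨ #-∷ (_∈? encode o (y ∷ w)) (o + toℕ x) V ⟩
    indicator (o + toℕ x ∈? encode o (y ∷ w)) + sharedVars V (encode o (y ∷ w))
      ≤⟨ +-mono-≤ (indicator-mono (o + toℕ x ∈? encode o (y ∷ w)) (x ≟ y) heads) tails ⟩
    agree (x ∷ v) (y ∷ w) ∎
    where
    open ≤-Reasoning
    V = encode (o + q) v
    tails : sharedVars V (encode o (y ∷ w)) ≤ agree v w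
    tails = ≤-trans
      (#-mono (_∈? encode o (y ∷ w)) (_∈? encode (o + q) w) V λ where
        -- The first variable of the other word lies in an earlier block than all of `V`.
        z∈V (here refl) → contradiction refl (<⇒≢ (All.lookup (encode-tail-> o y v) z∈V))
        z∈V (there z∈W) → z∈W)
      (shared≤agree (o + q) v w)
    heads : o + toℕ x ∈ encode o (y ∷ w) → x ≡ y
    heads (here eq) = toℕ-injective (+-cancelˡ-≡ o _ _ eq)
    heads (there x∈W) = contradiction refl (<⇒≢ (All.lookup (encode-tail-> o x w) x∈W))

-- Formulas with prescribed variable sets

lookup-AllPairs : ∀ {A : Set} {R : A → A → Set} → Symmetric R → ∀ {xs} → AllPairs R xs →
                  ∀ i j → i ≢ j → R (lookup xs i) (lookup xs j)
lookup-AllPairs sy {x ∷ xs} (r ∷ rs) zero    zero    i≢j = contradiction refl i≢j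
lookup-AllPairs sy {x ∷ xs} (r ∷ rs) zero    (suc j) i≢j = All.lookup r (∈-lookup j)
lookup-AllPairs sy {x ∷ xs} (r ∷ rs) (suc i) zero    i≢j = sy (All.lookup r (∈-lookup i))
lookup-AllPairs sy {x ∷ xs} (r ∷ rs) (suc i) (suc j) i≢j = lookup-AllPairs sy rs i j (i≢j ∘ cong suc)

unique-bounded⇒length≤ : ∀ {n xs} → Unique xs → All (_< n) xs → length xs ≤ n
unique-bounded⇒length≤ {n} {xs} u bounded = injective⇒≤ {f = index} λ {i} {j} → index-injective i j
  where
  index : Fin (length xs) → Fin n
  index i = fromℕ< (All.lookup bounded (∈-lookup i))
  index-injective : ∀ i j → index i ≡ index j → i ≡ j
  index-injective i j eq with i ≟ j
  ... | yes i≡j = i≡j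
  ... | no i≢j = contradiction (fromℕ<-injective _ _ _ _ eq) (lookup-AllPairs ≢-sym u i j i≢j)

-- Stated in both directions to be symmetric: `AllPairs` relates only earlier entries to later ones,
-- while `AlphaIntersecting` asks about positions in either order.
SharesAtMost : ℕ → List ℕ → List ℕ → Set
SharesAtMost α U V = sharedVars U V ≤ α × sharedVars V U ≤ α

-- A nonempty `V` occurring in `W` counts itself, so this bounds the degree from above.
neighbours : List ℕ → List (List ℕ) → ℕ
neighbours V W = # (λ U → 1 ≤? sharedVars V U) W

neighbours-vars : ∀ C F → # (λ D → 1 ≤? shared C D) F ≡ neighbours (vars C) (map vars F)
neighbours-vars C F = sym (#-map (λ U → 1 ≤? sharedVars (vars C) U) vars F)

-- Each pair is charged to the earlier of its two clauses, and the later clauses that this one meets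
-- are among its neighbours.
pairs-bound : ∀ {d} F → All (λ V → neighbours V (map vars F) ≤ d) (map vars F) →
              intersectionPairs F ≤ length F * d
pairs-bound [] [] = z≤n
pairs-bound {d} (C ∷ F) (few ∷ rest) = +-mono-≤
  (≤-trans (≤-reflexive (neighbours-vars C F)) (≤-trans (m≤n+m _ _)
    (≤-trans (≤-reflexive (sym (#-∷ (λ U → 1 ≤? sharedVars (vars C) U) (vars C) (map vars F)))) few)))
  (pairs-bound F (All.map (λ {V} le → ≤-trans (≤-trans (m≤n+m _ _)
    (≤-reflexive (sym (#-∷ (λ U → 1 ≤? sharedVars V U) (vars C) (map vars F))))) le) rest))

degree-bound : ∀ {d} F → All (λ V → neighbours V (map vars F) ≤ d) (map vars F) → MaxDegreeAtMost d F
degree-bound {d} F few i = begin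
  degree F i
    ≤⟨ #-mono _ (λ j → 1 ≤? shared Cᵢ (lookup F j)) (allFin _) (λ _ → proj₂) ⟩
  # (λ j → 1 ≤? shared Cᵢ (lookup F j)) (allFin _)
    ≡⟨ #-map (λ D → 1 ≤? shared Cᵢ D) (lookup F) (allFin _) ⟨
  # (λ D → 1 ≤? shared Cᵢ D) (map (lookup F) (allFin _))
    ≡⟨ cong (# (λ D → 1 ≤? shared Cᵢ D)) (trans (map-tabulate id (lookup F)) (tabulate-lookup F)) ⟩
  # (λ D → 1 ≤? shared Cᵢ D) F
    ≡⟨ neighbours-vars Cᵢ F ⟩
  neighbours (vars Cᵢ) (map vars F)
    ≤⟨ All.lookup (All.map⁻ few) (∈-lookup i) ⟩
  d ∎
  where
  open ≤-Reasoning
  Cᵢ = lookup F i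

numVars-bound : ∀ {n} F → All (All (_< n)) (map vars F) → numVars F ≤ n
numVars-bound F bounded =
  unique-bounded⇒length≤ (deduplicate-! (concat (map vars F))) (All.deduplicate⁺ ℕ._≟_ (All.concat⁺ bounded))

-- A clause shares all its `k > α` variables with itself, so a repeated clause would violate the
-- sharing bound.
sharing⇒unique : ∀ {k α} → α < k → ∀ F → All (λ V → length V ≡ k) (map vars F) →
                 AllPairs (SharesAtMost α) (map vars F) → Unique F
sharing⇒unique α<k [] _ _ = []
sharing⇒unique {k} {α} α<k (C ∷ F) (refl ∷ lengths) (close ∷ closes) =
  All.map (λ (le , _) → λ { refl → <⇒≱ α<k (≤-trans (≤-reflexive (sym self)) le) }) (All.map⁻ close)
  ∷ sharing⇒unique α<k F lengths closes
  where
  self : shared C C ≡ length (vars C)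
  self = cong length (filter-all (_∈? vars C) (All.tabulate id))

isKCNF : ∀ {k α} → α < k → ∀ F → All (λ V → length V ≡ k) (map vars F) → All (AllPairs _<_) (map vars F) →
         AllPairs (SharesAtMost α) (map vars F) → IsKCNF k F
isKCNF α<k F lengths increasing sharing =
  All.zipWith (λ {C} (inc , len) → AllPairs⇒Linked inc , trans (sym (length-map proj₁ C)) len)
    (All.map⁻ increasing , All.map⁻ lengths) ,
  sharing⇒unique α<k F lengths sharing

alphaIntersecting : ∀ {α} F → AllPairs (SharesAtMost α) (map vars F) → AlphaIntersecting α F
alphaIntersecting F sharing i j i≢j = proj₁ (lookup-AllPairs swap (AllPairs.map⁻ sharing) i j i≢j)

-- Numerical bounds

first-above : ∀ (f : ℕ → ℕ) X b → f 0 ≤ X → X < f b → ∃[ p ] f p ≤ X × X < f (suc p)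
first-above f X zero    f0≤X X<f0 = contradiction f0≤X (<⇒≱ X<f0)
first-above f X (suc b) f0≤X X<fb with f b ≤? X
... | yes fb≤X = b , fb≤X , X<fb
... | no fb≰X  = first-above f X b f0≤X (≰⇒> fb≰X)

-- `p` is the integer part of the `α`-th root of `X`. As `X ≥ 1`, also `p ≥ 1`, whence
-- `suc p ≤ 2 * p`.
approximate-root : ∀ α X .{{_ : NonZero α}} .{{_ : NonZero X}} →
                   ∃[ p ] X < suc p ^ α × suc p ^ α ≤ 2 ^ α * X
approximate-root α@(suc a) X@(suc x)
  -- `suc X` serves as upper end because `α ≥ 1` gives `suc X ≤ suc X ^ α`.
  with first-above (_^ α) X (suc X) z≤n
         (≤-trans (≤-reflexive (sym (*-identityʳ (suc X)))) (*-monoʳ-≤ (suc X) (m^n>0 (suc X) a)))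
... | zero , _ , X<1 = contradiction (≤-trans X<1 (≤-reflexive (^-zeroˡ α))) (λ { (s≤s ()) })
... | p@(suc p′) , p^α≤X , X<q^α = p , X<q^α , (begin
  suc p ^ α       ≤⟨ ^-monoˡ-≤ α (≤-trans (+-monoˡ-≤ p (s≤s z≤n)) (≤-reflexive (double p))) ⟩
  (2 * p) ^ α     ≡⟨ ^-distribʳ-* α 2 p ⟩
  2 ^ α * p ^ α   ≤⟨ *-monoʳ-≤ (2 ^ α) p^α≤X ⟩
  2 ^ α * X       ∎)
  where
  open ≤-Reasoning
  double : ∀ p → p + p ≡ 2 * p
  double = solve-∀

-- Assembling the formula

module _ (k α q : ℕ) .{{_ : NonZero q}} .{{_ : NonZero k}} (α<k : α < k)
         (X<q^α : k * 2 ^ k * k ^ suc α < q ^ α) where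

  open Words q

  private
    s n : ℕ
    -- `s` words with their `q` shifts give `s * q = 2 ^ k * n` clauses, the number that
    -- `unsat-signs` asks for when there are `n = k * q` variables.
    s = k * 2 ^ k
    n = k * q

    clauses≡2^k*vars : s * q ≡ 2 ^ k * n
    clauses≡2^k*vars = regroup k (2 ^ k) q
      where
      regroup : ∀ k e q → k * e * q ≡ e * (k * q)
      regroup = solve-∀

  variable-sets : ∃[ W ] All (λ V → length V ≡ k) W × All (AllPairs _<_) W × All (All (_< n)) W
                  × AllPairs (SharesAtMost α) W × All (λ V → neighbours V W ≤ s * k) W × length W ≡ s * q
  variable-sets with S , size , apart ← apart-words {k} {α} s X<q^α =
    map (encode 0) (orbits S) ,
    everywhere (length-encode 0) ,
    everywhere (encode-increasing 0) ,
    everywhere (encode-< 0) ,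
    AllPairs.map⁺ (AllPairs.map (λ {v} {w} le →
      ≤-trans (shared≤agree 0 v w) le , ≤-trans (shared≤agree 0 w v) (≤-trans (agree-sym w v) le))
      (orbits-agree apart)) ,
    everywhere (λ v → begin
      neighbours (encode 0 v) (map (encode 0) (orbits S))
        ≡⟨ #-map (λ U → 1 ≤? sharedVars (encode 0 v) U) (encode 0) (orbits S) ⟩
      # (λ w → 1 ≤? sharedVars (encode 0 v) (encode 0 w)) (orbits S)
        ≤⟨ #-mono _ (λ w → 1 ≤? agree v w) (orbits S) (λ {w} _ le → ≤-trans le (shared≤agree 0 v w)) ⟩
      # (λ w → 1 ≤? agree v w) (orbits S)
        ≤⟨ orbits-hits v S ⟩
      length S * k
        ≡⟨ cong (_* k) size ⟩
      s * k ∎) ,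
    trans (length-map (encode 0) (orbits S)) (trans (length-orbits S) (cong (_* q) size))
    where
    open ≤-Reasoning
    everywhere : ∀ {P : List ℕ → Set} {ws} → (∀ (w : Word k) → P (encode 0 w)) → All P (map (encode 0) ws)
    everywhere p = All.map⁺ (All.universal p _)

  -- Everything except unsatisfiability is derived from the variable sets alone, so the signs can be
  -- chosen last.
  sparse-formula : ∃[ F ] IsKCNF k F × Unsatisfiable F × AlphaIntersecting α F
                   × intersectionPairs F ≤ s * q * (s * k) × numVars F ≤ n
                   × numClauses F ≡ s * q × MaxDegreeAtMost (s * k) F
  sparse-formula
    with W , lengths , increasing , bounded , sharing , few , size ← variable-sets
    with F , refl , unsat ← unsat-signs k n {{it}} {{m*n≢0 k q}} W lengths bounded
                              (trans size clauses≡2^k*vars) =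
    F , isKCNF α<k F lengths increasing sharing , unsat , alphaIntersecting F sharing ,
    ≤-trans (pairs-bound F few) (≤-reflexive (cong (_* (s * k)) clauses)) ,
    numVars-bound F bounded , clauses , degree-bound F few
    where
    clauses = trans (sym (length-map vars F)) size

-- Comparison with the stated bounds

^-pad : ∀ b .{{_ : NonZero b}} x z {y} → x + z ≡ y → b ^ x ≤ b ^ y
^-pad b x z refl = ^-monoʳ-≤ b (m≤m+n x z)

-- Clause pairs, variables and clauses are all bounded by some `k ^ a * 2 ^ b * q`, with `(a , b)`
-- equal to `(3 , k + k)`, `(1 , 0)` and `(1 , k)`. Taking `α`-th powers lets the estimate for
-- `q ^ α` be inserted without roots.
power-bound : ∀ {k α q} → q ^ α ≤ 2 ^ α * (k * 2 ^ k * k ^ suc α) → ∀ a b →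
              (k ^ a * 2 ^ b * q) ^ α ≤ 2 ^ (b * α + (α + k)) * k ^ (a * α + (2 + α))
power-bound {k} {α} {q} small a b = begin
  (k ^ a * 2 ^ b * q) ^ α
    ≡⟨ ^-distribʳ-* α (k ^ a * 2 ^ b) q ⟩
  (k ^ a * 2 ^ b) ^ α * q ^ α
    ≤⟨ *-monoʳ-≤ ((k ^ a * 2 ^ b) ^ α) small ⟩
  (k ^ a * 2 ^ b) ^ α * (2 ^ α * (k * 2 ^ k * k ^ suc α))
    ≡⟨ cong (_* (2 ^ α * (k * 2 ^ k * k ^ suc α)))
            (trans (^-distribʳ-* α (k ^ a) (2 ^ b)) (cong₂ _*_ (^-*-assoc k a α) (^-*-assoc 2 b α))) ⟩
  k ^ (a * α) * 2 ^ (b * α) * (2 ^ α * (k * 2 ^ k * k ^ suc α))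
    ≡⟨ regroup (k ^ (a * α)) (2 ^ (b * α)) (2 ^ α) k (2 ^ k) (k ^ suc α) ⟩
  2 ^ (b * α) * (2 ^ α * 2 ^ k) * (k ^ (a * α) * k ^ (2 + α))
    ≡⟨ cong (λ e → 2 ^ (b * α) * e * (k ^ (a * α) * k ^ (2 + α))) (^-distribˡ-+-* 2 α k) ⟨
  2 ^ (b * α) * 2 ^ (α + k) * (k ^ (a * α) * k ^ (2 + α))
    ≡⟨ cong₂ _*_ (^-distribˡ-+-* 2 (b * α) (α + k)) (^-distribˡ-+-* k (a * α) (2 + α)) ⟨
  2 ^ (b * α + (α + k)) * k ^ (a * α + (2 + α)) ∎
  where
  open ≤-Reasoning
  regroup : ∀ p x y k z w → p * x * (y * (k * z * w)) ≡ x * (y * z) * (p * (k * w))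
  regroup = solve-∀

-- The bounds with `1/α` in an exponent are expressed through `α`-th powers, an equivalent form that
-- stays in the natural numbers.
theorem3 : (k α : ℕ) → 1 ≤ α → α < k →
    ∃[ F ] (IsKCNF k F × Unsatisfiable F × AlphaIntersecting α F
    × intersectionPairs F ^ α ≤ α ^ (2 * α) * 2 ^ ((k + α) * (2 * α + 1)) * k ^ (5 * α + 2)
    × numVars F ^ α ≤ (2 * α) ^ α * 2 ^ k * k ^ (2 * α + 2)
    × numClauses F ^ α ≤ α ^ α * 2 ^ ((k + α) * (α + 1)) * k ^ (2 * α + 2)
    × MaxDegreeAtMost (α * 2 ^ (k + α) * k ^ 2) F)
theorem3 k@(suc _) α@(suc a) 1≤α α<k
  with p , X<q^α , q^α≤ ← approximate-root α (k * 2 ^ k * k ^ suc α) {{it}}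
         {{m*n≢0 _ _ {{m*n≢0 k (2 ^ k) {{it}} {{m^n≢0 2 k}}}} {{m^n≢0 k (suc α)}}}}
  with F , kcnf , unsat , sharing , pairs , variables , clauses , degrees ← sparse-formula k α (suc p) α<k X<q^α =
  F , kcnf , unsat , sharing ,
  (begin
    intersectionPairs F ^ α
      ≤⟨ ^-monoˡ-≤ α pairs ⟩
    (k * 2 ^ k * q * (k * 2 ^ k * k)) ^ α
      ≡⟨ cong (_^ α) (trans (regroup k (2 ^ k) q) (cong (λ e → k ^ 3 * e * q) (sym (^-distribˡ-+-* 2 k k)))) ⟩
    (k ^ 3 * 2 ^ (k + k) * q) ^ α
      ≤⟨ power-bound {k} {α} {q} q^α≤ 3 (k + k) ⟩
    2 ^ ((k + k) * α + (α + k)) * k ^ (3 * α + (2 + α))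
      -- The slack is `2 ^ (2 * α * α)` and `k ^ α`.
      ≤⟨ *-mono-≤ (^-pad 2 ((k + k) * α + (α + k)) (2 * α * α) (pairs-exponent₂ α k))
                  (^-pad k (3 * α + (2 + α)) α (pairs-exponentₖ α)) ⟩
    2 ^ ((k + α) * (2 * α + 1)) * k ^ (5 * α + 2)
      ≤⟨ *-monoˡ-≤ _ (m≤n*m _ (α ^ (2 * α)) {{m^n≢0 α (2 * α)}}) ⟩
    α ^ (2 * α) * 2 ^ ((k + α) * (2 * α + 1)) * k ^ (5 * α + 2) ∎) ,
  (begin
    numVars F ^ α
      ≤⟨ ^-monoˡ-≤ α variables ⟩
    (k * q) ^ α
      ≡⟨ cong (_^ α) (vars-factors k q) ⟩
    (k ^ 1 * 2 ^ 0 * q) ^ α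
      ≤⟨ power-bound {k} {α} {q} q^α≤ 1 0 ⟩
    2 ^ (α + k) * k ^ (1 * α + (2 + α))
      ≡⟨ cong₂ _*_ (^-distribˡ-+-* 2 α k) (cong (k ^_) (exponentₖ α)) ⟩
    2 ^ α * 2 ^ k * k ^ (2 * α + 2)
      ≤⟨ *-monoˡ-≤ _ (*-monoˡ-≤ (2 ^ k) (^-monoˡ-≤ α (m≤m*n 2 α))) ⟩
    (2 * α) ^ α * 2 ^ k * k ^ (2 * α + 2) ∎) ,
  (begin
    numClauses F ^ α
      ≡⟨ cong (_^ α) (trans clauses (cong (λ e → e * 2 ^ k * q) (sym (*-identityʳ k)))) ⟩
    (k ^ 1 * 2 ^ k * q) ^ α
      ≤⟨ power-bound {k} {α} {q} q^α≤ 1 k ⟩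
    2 ^ (k * α + (α + k)) * k ^ (1 * α + (2 + α))
      -- The slack is `2 ^ (α * α)`; the exponents of `k` coincide.
      ≤⟨ *-mono-≤ (^-pad 2 (k * α + (α + k)) (α * α) (clauses-exponent₂ α k))
                  (≤-reflexive (cong (k ^_) (exponentₖ α))) ⟩
    2 ^ ((k + α) * (α + 1)) * k ^ (2 * α + 2)
      ≤⟨ *-monoˡ-≤ _ (m≤n*m _ (α ^ α) {{m^n≢0 α α}}) ⟩
    α ^ α * 2 ^ ((k + α) * (α + 1)) * k ^ (2 * α + 2) ∎) ,
  λ i → begin
    degree F i                 ≤⟨ degrees i ⟩
    k * 2 ^ k * k              ≡⟨ square k (2 ^ k) ⟩
    2 ^ k * k ^ 2              ≤⟨ *-monoˡ-≤ (k ^ 2) (≤-trans (^-monoʳ-≤ 2 (m≤m+n k α)) (m≤n*m _ α)) ⟩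
    α * 2 ^ (k + α) * k ^ 2    ∎
  where
  open ≤-Reasoning
  q = suc p
  regroup : ∀ k e q → k * e * q * (k * e * k) ≡ k * (k * (k * 1)) * (e * e) * q
  regroup = solve-∀
  square : ∀ k e → k * e * k ≡ e * (k * (k * 1))
  square = solve-∀
  vars-factors : ∀ k q → k * q ≡ k * 1 * 1 * q
  vars-factors = solve-∀
  exponentₖ : ∀ α → 1 * α + (2 + α) ≡ 2 * α + 2
  exponentₖ = solve-∀
  pairs-exponentₖ : ∀ α → 3 * α + (2 + α) + α ≡ 5 * α + 2
  pairs-exponentₖ = solve-∀
  pairs-exponent₂ : ∀ α k → (k + k) * α + (α + k) + 2 * α * α ≡ (k + α) * (2 * α + 1)
  pairs-exponent₂ = solve-∀
  clauses-exponent₂ : ∀ α k → k * α + (α + k) + α * α ≡ (k + α) * (α + 1)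
  clauses-exponent₂ = solve-∀
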